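{- Let $G$ be a $k$-regular graph on $n$ vertices, let $\lambda$ be an MCSD of $G$, and let $\gamma_1<\cdots<\gamma_k$ be the labels used by $\lambda$. Then $G$ decomposes into $\lfloor k/2\rfloor$ $2$-factors and, if $k$ is odd, a perfect matching as well. For $1\le i\le\lfloor k/2\rfloor$, the edges of the $i$th $2$-factor are labeled with $\gamma_i$, and the edges of the perfect matching (when $k$ is odd) are labeled with $n/2$.
   Context: Graphs are finite, undirected, without multiple edges or self-loops. An edge labeling $\lambda$ of $G$ assigns to every edge $uv$ two labels, $\lambda_u(uv)$ corresponding to $u$ and $\lambda_v(uv)$ corresponding to $v$. It is a chordal sense of direction (CSD) if there is a cyclic ordering of the vertices, i.e. a bijection $r:V(G)\to\{0,\ldots,n-1\}$ (the rank), such that for every edge $uv$ the label $\lambda_u(uv)\in\{1,\ldots,n-1\}$ equals $r(v)-r(u)$ modulo $n$ (and likewise $\lambda_v(uv)$ equals $r(u)-r(v)$ modulo $n$). It is a minimal chordal sense of direction (MCSD) if moreover the total number of distinct labels used is exactly $\Delta(G)$, the maximum degree of $G$; thus for $k$-regular $G$ exactly $k$ labels are used. A graph decomposes into given subgraphs if their vertex sets have union $V(G)$, their edge sets have union $E(G)$, and their edge sets are pairwise disjoint. A $2$-factor of $G$ is a collection of vertex-disjoint cycles of $G$ that spans all vertices. An edge $uv$ is labeled with $\gamma$ if one of its two labels $\lambda_u(uv),\lambda_v(uv)$ is $\gamma$ (the other being then $n-\gamma$). -}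

module Defs where

open import Data.Bool.Base using (Bool; T)
open import Data.Fin.Base using (Fin; toℕ)
open import Data.Fin.Subset using (Subset; ∣_∣)
open import Data.Integer.Base as ℤ using (ℤ; +_)
open import Data.Integer.Divisibility as ℤ using ()
open import Data.List.Base using (map; allFin)
open import Data.List.Extrema.Nat using (max)
open import Data.Nat.Base using (ℕ; suc; _+_; _<_; _≤_)
open import Data.Nat.DivMod using (_mod_)
open import Data.Product.Base using (Σ-syntax; ∃-syntax; _×_; _,_)
open import Data.Product using (∃!)
open import Data.Sum.Base using (_⊎_; inj₁; inj₂; swap)
open import Data.Vec.Base using (tabulate)
open import Function.Base using (_∘_)
open import Function.Bundles using (_⤖_; _⇔_; module Bijection)
open import Function.Definitions using (Injective)
open import Relation.Binary.PropositionalEquality using (_≡_; _≢_; refl)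
open import Relation.Nullary using (¬_)

-- Adjacency is Boolean-valued so that degrees can be counted and so that
-- each edge has exactly one proof.
record Graph (n : ℕ) : Set where
  field
    adj        : Fin n → Fin n → Bool
    adj-sym    : ∀ u v → T (adj u v) → T (adj v u)
    adj-irrefl : ∀ v → ¬ T (adj v v)

  Adj : Fin n → Fin n → Set
  Adj u v = T (adj u v)

  neighbours : Fin n → Subset n
  neighbours v = tabulate (adj v)

  degree : Fin n → ℕ
  degree v = ∣ neighbours v ∣

  maxDegree : ℕ
  maxDegree = max 0 (map degree (allFin n))

  Regular : ℕ → Set
  Regular k = ∀ v → degree v ≡ k

open Graph

-- For an edge e from u to v, lab u v e is the label of uv at the endpoint u;
-- its label at v is lab v u of the reversed edge.
Labeling : ∀ {n} → Graph n → Set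
Labeling G = ∀ u v → Adj G u v → ℕ

module _ {n : ℕ} (G : Graph n) where

  IsCSD : Labeling G → Set
  IsCSD lab = Σ[ r ∈ Fin n ⤖ Fin n ]
    (let rank : Fin n → ℤ
         rank v = + toℕ (Bijection.to r v)
     in ∀ u v (e : Adj G u v) →
          1 ≤ lab u v e
        × lab u v e < n
        × + n ℤ.∣ (+ lab u v e ℤ.- (rank v ℤ.- rank u)))

  Used : Labeling G → ℕ → Set
  Used lab ℓ = ∃[ u ] ∃[ v ] Σ[ e ∈ Adj G u v ] lab u v e ≡ ℓ

  UsesExactly : Labeling G → ∀ {m} → (Fin m → ℕ) → Set
  UsesExactly lab γ = ∀ ℓ → Used lab ℓ ⇔ (∃[ i ] γ i ≡ ℓ)

  NumberOfLabels : Labeling G → ℕ → Set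
  NumberOfLabels lab m =
    Σ[ γ ∈ (Fin m → ℕ) ] Injective _≡_ _≡_ γ × UsesExactly lab γ

  IsMCSD : Labeling G → Set
  IsMCSD lab = IsCSD lab × NumberOfLabels lab (maxDegree G)

  LabeledWith : Labeling G → ℕ → ∀ u v → Adj G u v → Set
  LabeledWith lab ℓ u v e = lab u v e ≡ ℓ ⊎ lab v u (adj-sym G u v e) ≡ ℓ

  record Subgraph : Set₁ where
    field
      V     : Fin n → Set
      E     : Fin n → Fin n → Set
      E-sym : ∀ {u v} → E u v → E v u
      E⇒V   : ∀ {u v} → E u v → V u
      E⇒Adj : ∀ {u v} → E u v → Adj G u v

  open Subgraph

  EdgesLabeledWith : Labeling G → ℕ → Subgraph → Set
  EdgesLabeledWith lab ℓ H = ∀ u v (e : E H u v) → LabeledWith lab ℓ u v (E⇒Adj H e)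

  -- The reverse inclusions for both unions are part of being a subgraph.
  record DecomposesInto {m : ℕ} (H : Fin m → Subgraph) : Set where
    field
      vertices-covered : ∀ v → ∃[ i ] V (H i) v
      edges-covered    : ∀ u v → Adj G u v → ∃[ i ] E (H i) u v
      edge-disjoint    : ∀ i j → i ≢ j → ∀ u v → E (H i) u v → ¬ E (H j) u v

  ⋃ : ∀ {m} → (Fin m → Subgraph) → Subgraph
  ⋃ H .V v            = ∃[ i ] V (H i) v
  ⋃ H .E u v          = ∃[ i ] E (H i) u v
  ⋃ H .E-sym (i , e)  = i , E-sym (H i) e
  ⋃ H .E⇒V   (i , e)  = i , E⇒V (H i) e
  ⋃ H .E⇒Adj (i , e)  = E⇒Adj (H i) e

  next : ∀ {m} → Fin (suc m) → Fin (suc m)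
  next {m} i = suc (toℕ i) mod suc m

  -- A cycle of length 3 + excess: a simple graph has no shorter cycles.
  record Cycle : Set where
    field
      excess   : ℕ
      vertex   : Fin (3 + excess) → Fin n
      distinct : Injective _≡_ _≡_ vertex
      adjacent : ∀ i → Adj G (vertex i) (vertex (next i))

    Step : Fin n → Fin n → Set
    Step u v = ∃[ i ] (vertex i ≡ u × vertex (next i) ≡ v)

    subgraph : Subgraph
    subgraph .V v   = ∃[ i ] vertex i ≡ v
    subgraph .E u v = Step u v ⊎ Step v u
    subgraph .E-sym = swap
    subgraph .E⇒V (inj₁ (i , p , _)) = i , p
    subgraph .E⇒V (inj₂ (i , _ , q)) = next i , q
    subgraph .E⇒Adj (inj₁ (i , refl , refl)) = adjacent i
    subgraph .E⇒Adj (inj₂ (i , refl , refl)) = adj-sym G _ _ (adjacent i)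

  record TwoFactor : Set where
    field
      size            : ℕ
      cycle           : Fin size → Cycle
      vertex-disjoint : ∀ i j → i ≢ j → ∀ v →
                        V (Cycle.subgraph (cycle i)) v → ¬ V (Cycle.subgraph (cycle j)) v
      spanning        : ∀ v → ∃[ i ] V (Cycle.subgraph (cycle i)) v

    subgraph : Subgraph
    subgraph = ⋃ (Cycle.subgraph ∘ cycle)

  IsPerfectMatching : Subgraph → Set
  IsPerfectMatching M = ∀ v → V M v × ∃! _≡_ (E M v)

{-# OPTIONS --safe #-}
-- A vertex has k neighbours, reached along k distinct labels, so every label γᵢ leads from
-- every vertex to exactly one neighbour, namely the vertex whose rank is larger by γᵢ mod n.
-- The labels are closed under γ ↦ n − γ; being decreasing, this involution pairs γᵢ with its
-- mirror image γ_{k+1−i}. Hence 2γᵢ < n for i ≤ ⌊k/2⌋, and the rotation of ℤ/n by γᵢ splits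
-- the vertices into gcd(n,γᵢ) cycles of length n/gcd(n,γᵢ) ≥ 3. For odd k the middle label
-- is its own mirror image n/2, and its edges form the matching.
module Submission where

open import Defs
open import Data.Fin.Base using (Fin; inject≤)
open import Data.Fin.Base as Fin using ()
open import Data.Nat.Base using (ℕ; _≤_; _<_; ⌊_/2⌋)
open import Data.Nat.Divisibility using (_∣_)
open import Data.Nat.Properties using (⌊n/2⌋≤n)
open import Data.Product.Base using (Σ-syntax; _×_)
open import Data.Vec.Functional using (_∷_)
open import Relation.Nullary using (¬_)

open import Data.Bool.Base using (T)
open import Data.Fin.Base using (zero; suc; toℕ; fromℕ<; opposite; punchOut)
open import Data.Fin.Properties as Fin using
  (toℕ<n; toℕ-fromℕ<; toℕ-injective; toℕ-inject≤; opposite-prop; opposite-involutive; punchOut-injective;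
   injective⇒≤; any?)
open import Data.Fin.Subset using (Subset; inside; outside; ∣_∣; _∈_)
open import Data.Integer.Base as ℤ using (+_; _⊖_)
open import Data.Integer.Divisibility as ℤ using ()
open import Data.Integer.Properties as ℤ using ()
open import Data.Integer.Tactic.RingSolver as ℤ using ()
open import Data.Nat.Base using
  (zero; suc; pred; _+_; _*_; _∸_; ∣_-_∣; z≤n; s≤s; s≤s⁻¹; NonZero; ≢-nonZero; ≢-nonZero⁻¹)
open import Data.Nat.Coprimality using (Coprime; coprime-divisor; GCD≡1⇒coprime)
open import Data.Nat.DivMod
open import Data.Nat.Divisibility using
  (quotient; divides; ∣⇒≤; ∣-trans; ∣n⇒∣m*n; ∣m+n∣m⇒∣n; *-cancelʳ-∣; m∣n⇒n≡quotient*m; m%n≡0⇒n∣m; n∣m⇒m%n≡0)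
open import Data.Nat.GCD using (gcd; gcd-GCD; GCD; GCD-*; gcd[m,n]∣m; gcd[m,n]∣n; gcd[m,n]≢0; module Bézout)
open import Data.Nat.Properties
open import Data.Nat.Tactic.RingSolver using (solve-∀)
open import Data.Product.Base using (∃-syntax; _,_; proj₁; proj₂)
open import Data.Sum.Base using (_⊎_; inj₁; inj₂; [_,_]′)
open import Data.Unit.Base using (⊤; tt)
open import Data.Vec.Base using (here; there) renaming ([] to []ᵥ; _∷_ to _∷ᵥ_)
open import Data.Vec.Properties using ([]=⇒lookup; lookup∘tabulate)
open import Function.Base using (_∘_; id)
open import Function.Bundles using (_⤖_; module Bijection; module Inverse; module Equivalence)
open import Function.Definitions using (Injective)
open import Function.Properties.Bijection using (⤖⇒↔)
open import Relation.Binary.Bundles using (Setoid)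
open import Relation.Binary.Definitions using (tri<; tri≈; tri>)
open import Relation.Binary.PropositionalEquality
open import Relation.Nullary using (yes; no; contradiction)

-- Self-maps of finite sets, enumeration of subsets, parity.

-- Punching a missed value out of the codomain would leave an injection from `Fin (suc m)` into
-- `Fin m`.
injective⇒covering : ∀ {m} {f : Fin m → Fin m} → Injective _≡_ _≡_ f → ∀ y → ∃[ x ] f x ≡ y
injective⇒covering {suc m} {f} f-inj y with any? (λ x → f x Fin.≟ y)
... | yes found = found
... | no missed = contradiction
        (injective⇒≤ {f = λ x → punchOut (y≢f x)}
          (λ {x} {x′} eq → f-inj (punchOut-injective (y≢f x) (y≢f x′) eq)))
        1+n≰n
  where
  y≢f : ∀ x → y ≢ f x
  y≢f x y≡fx = missed (x , sym y≡fx)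

enumerate : ∀ {n} (p : Subset n) →
  Σ[ f ∈ (Fin ∣ p ∣ → Fin n) ] Injective _≡_ _≡_ f × (∀ i → f i ∈ p)
enumerate []ᵥ = (λ ()) , (λ { {()} }) , λ ()
enumerate (outside ∷ᵥ p) with f , f-inj , f∈p ← enumerate p =
  suc ∘ f , f-inj ∘ Fin.suc-injective , there ∘ f∈p
enumerate {suc n} (inside ∷ᵥ p) with f , f-inj , f∈p ← enumerate p = g , g-inj , g∈p
  where
  g : Fin (suc ∣ p ∣) → Fin (suc n)
  g zero    = zero
  g (suc i) = suc (f i)

  g-inj : Injective _≡_ _≡_ g
  g-inj {zero}  {zero}  _  = refl
  g-inj {suc _} {suc _} eq = cong suc (f-inj (Fin.suc-injective eq))

  g∈p : ∀ i → g i ∈ inside ∷ᵥ p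
  g∈p zero    = here
  g∈p (suc i) = there (f∈p i)

-- The size is a variable here so that its equation can be matched against `refl`.
enumerate-size : ∀ {n k} (p : Subset n) → ∣ p ∣ ≡ k →
  Σ[ f ∈ (Fin k → Fin n) ] Injective _≡_ _≡_ f × (∀ i → f i ∈ p)
enumerate-size p refl = enumerate p

strictlyMonotone⇒inflationary : ∀ {k} (f : Fin k → Fin k) →
  (∀ {i j} → i Fin.< j → f i Fin.< f j) → ∀ i → toℕ i ≤ toℕ (f i)
strictlyMonotone⇒inflationary {k} f f-mono i = go (toℕ i) i refl
  where
  go : ∀ m i → toℕ i ≡ m → m ≤ toℕ (f i)
  go zero    i _  = z≤n
  go (suc m) i eq = ≤-<-trans (go m j toℕj) (f-mono j<i)
    where
    m<i : m < toℕ i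
    m<i = ≤-reflexive (sym eq)
    j : Fin k
    j = fromℕ< (<-trans m<i (toℕ<n i))
    toℕj : toℕ j ≡ m
    toℕj = toℕ-fromℕ< _
    j<i : j Fin.< i
    j<i = subst (_< toℕ i) (sym toℕj) m<i

opposite-antitone : ∀ {k} {i j : Fin k} → i Fin.< j → opposite j Fin.< opposite i
opposite-antitone {k} {i} {j} i<j
  rewrite opposite-prop i | opposite-prop j = ∸-monoʳ-< (s≤s i<j) (toℕ<n j)

toℕ-opposite : ∀ {k} (i : Fin k) → suc (toℕ i) + toℕ (opposite i) ≡ k
toℕ-opposite i rewrite opposite-prop i = m+[n∸m]≡n (toℕ<n i)

-- Both `f ∘ opposite` and `opposite ∘ f` are strictly monotone, hence inflationary. The first
-- bounds `f i` from below by `opposite i`; the second gives `i ≤ opposite (f i)`, which is the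
-- upper bound after reflection.
strictlyAntitone⇒opposite : ∀ {k} (f : Fin k → Fin k) →
  (∀ {i j} → i Fin.< j → f j Fin.< f i) → ∀ i → f i ≡ opposite i
strictlyAntitone⇒opposite f f-anti i = toℕ-injective (≤-antisym fi≤ ≤fi)
  where
  ≤fi : toℕ (opposite i) ≤ toℕ (f i)
  ≤fi = subst (λ j → toℕ (opposite i) ≤ toℕ (f j)) (opposite-involutive i)
    (strictlyMonotone⇒inflationary (f ∘ opposite) (f-anti ∘ opposite-antitone) (opposite i))
  fi≤ : toℕ (f i) ≤ toℕ (opposite i)
  fi≤ = +-cancelˡ-≤ (suc (toℕ i)) _ _ (begin
    suc (toℕ i) + toℕ (f i)               ≤⟨ +-monoˡ-≤ _ (s≤s (strictlyMonotone⇒inflationary (opposite ∘ f) (opposite-antitone ∘ f-anti) i)) ⟩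
    suc (toℕ (opposite (f i))) + toℕ (f i) ≡⟨ cong suc (+-comm (toℕ (opposite (f i))) _) ⟩
    suc (toℕ (f i)) + toℕ (opposite (f i)) ≡⟨ toℕ-opposite (f i) ⟩
    _                                      ≡⟨ toℕ-opposite i ⟨
    suc (toℕ i) + toℕ (opposite i)         ∎)
    where open ≤-Reasoning

⌊n/2⌋+⌊n/2⌋-parity : ∀ n → ⌊ n /2⌋ + ⌊ n /2⌋ ≡ n ⊎ suc (⌊ n /2⌋ + ⌊ n /2⌋) ≡ n
⌊n/2⌋+⌊n/2⌋-parity zero    = inj₁ refl
⌊n/2⌋+⌊n/2⌋-parity (suc zero) = inj₂ refl
⌊n/2⌋+⌊n/2⌋-parity (suc (suc n)) rewrite +-suc ⌊ n /2⌋ ⌊ n /2⌋ with ⌊n/2⌋+⌊n/2⌋-parity n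
... | inj₁ eq = inj₁ (cong (_+_ 2) eq)
... | inj₂ eq = inj₂ (cong (_+_ 2) eq)

2∣m+m : ∀ m → 2 ∣ m + m
2∣m+m m = divides m (trans (cong (_+_ m) (sym (+-identityʳ m))) (*-comm 2 m))

2∤1+m+m : ∀ m → ¬ 2 ∣ suc (m + m)
2∤1+m+m m 2∣ with s≤s () ← ∣⇒≤ (∣m+n∣m⇒∣n (subst (2 ∣_) (+-comm 1 (m + m)) 2∣) (2∣m+m m))

-- Congruence of natural numbers modulo `n`.

module Congruence (n : ℕ) .{{_ : NonZero n}} where

  infix 4 _≈_

  -- A record, so that x and y can be inferred from a proof of x ≈ y.
  record _≈_ (x y : ℕ) : Set where
    constructor %-eq
    field eq : x % n ≡ y % n

  open _≈_ public

  ≈-refl : ∀ {x} → x ≈ x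
  ≈-refl = %-eq refl

  ≈-sym : ∀ {x y} → x ≈ y → y ≈ x
  ≈-sym (%-eq p) = %-eq (sym p)

  ≈-trans : ∀ {x y z} → x ≈ y → y ≈ z → x ≈ z
  ≈-trans (%-eq p) (%-eq q) = %-eq (trans p q)

  ≈-reflexive : ∀ {x y} → x ≡ y → x ≈ y
  ≈-reflexive refl = ≈-refl

  ≈-setoid : Setoid _ _
  ≈-setoid = record
    { Carrier = ℕ ; _≈_ = _≈_
    ; isEquivalence = record { refl = ≈-refl ; sym = ≈-sym ; trans = ≈-trans } }

  %-≈ : ∀ x → x % n ≈ x
  %-≈ x = %-eq (m%n%n≡m%n x n)

  +k*n-≈ : ∀ x k → x + k * n ≈ x
  +k*n-≈ x k = %-eq ([m+kn]%n≡m%n x k n)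

  +-cong-≈ : ∀ {x x′ y y′} → x ≈ x′ → y ≈ y′ → x + y ≈ x′ + y′
  +-cong-≈ {x} {x′} {y} {y′} (%-eq p) (%-eq q) = %-eq (begin
    (x + y) % n              ≡⟨ %-distribˡ-+ x y n ⟩
    (x % n + y % n) % n      ≡⟨ cong₂ (λ a b → (a + b) % n) p q ⟩
    (x′ % n + y′ % n) % n    ≡⟨ %-distribˡ-+ x′ y′ n ⟨
    (x′ + y′) % n            ∎)
    where open ≡-Reasoning

  *-congˡ-≈ : ∀ a {x y} → x ≈ y → a * x ≈ a * y
  *-congˡ-≈ zero    p = ≈-refl
  *-congˡ-≈ (suc a) p = +-cong-≈ p (*-congˡ-≈ a p)

  +-cancelˡ-≈ : ∀ a {x y} → a + x ≈ a + y → x ≈ y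
  +-cancelˡ-≈ a {x} {y} p =
    ≈-trans (shift x) (≈-trans (+-cong-≈ (≈-refl {a * pred n}) p) (≈-sym (shift y)))
    where
    -- `a * pred n` stands in for the negative of `a`: together with `a` it makes `a * n`.
    shift : ∀ x → x ≈ a * pred n + (a + x)
    shift x = ≈-trans (≈-sym (+k*n-≈ x a)) (≈-reflexive (begin
      x + a * n                                 ≡⟨ cong (λ m → x + a * m) (sym (suc-pred n)) ⟩
      x + a * suc (pred n)        ≡⟨ lemma x a _ ⟩
      a * pred n + (a + x)        ∎))
      where
      open ≡-Reasoning
      lemma : ∀ x a m → x + a * suc m ≡ a * m + (a + x)
      lemma = solve-∀

  ≈⇒≡ : ∀ {x y} → x < n → y < n → x ≈ y → x ≡ y
  ≈⇒≡ x<n y<n (%-eq p) = trans (sym (m<n⇒m%n≡m x<n)) (trans p (m<n⇒m%n≡m y<n))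

  ≈0⇒∣ : ∀ {x} → x ≈ 0 → n ∣ x
  ≈0⇒∣ {x} (%-eq p) = m%n≡0⇒n∣m x n (trans p (m*n%n≡0 0 n))

  ∣⇒≈0 : ∀ {x} → n ∣ x → x ≈ 0
  ∣⇒≈0 {x} n∣x = %-eq (trans (n∣m⇒m%n≡0 x n n∣x) (sym (m*n%n≡0 0 n)))

  ≤∧∣∸⇒≈ : ∀ {x y} → x ≤ y → n ∣ y ∸ x → x ≈ y
  ≤∧∣∸⇒≈ {x} {y} x≤y n∣ = begin
    x           ≡⟨ +-identityʳ x ⟨
    x + 0       ≈⟨ +-cong-≈ (≈-refl {x}) (∣⇒≈0 n∣) ⟨
    x + (y ∸ x) ≡⟨ m+[n∸m]≡n x≤y ⟩
    y           ∎
    where open import Relation.Binary.Reasoning.Setoid ≈-setoid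

  ≤∧≈⇒∣∸ : ∀ {x y} → x ≤ y → x ≈ y → n ∣ y ∸ x
  ≤∧≈⇒∣∸ {x} {y} x≤y p = ≈0⇒∣ (+-cancelˡ-≈ x (begin
    x + (y ∸ x) ≡⟨ m+[n∸m]≡n x≤y ⟩
    y           ≈⟨ p ⟨
    x           ≡⟨ +-identityʳ x ⟨
    x + 0       ∎))
    where open import Relation.Binary.Reasoning.Setoid ≈-setoid

  ∣-∣⇒≈ : ∀ {x y} → n ∣ ∣ x - y ∣ → x ≈ y
  ∣-∣⇒≈ {x} {y} n∣ with ≤-total x y
  ... | inj₁ x≤y = ≤∧∣∸⇒≈ x≤y (subst (n ∣_) (m≤n⇒∣m-n∣≡n∸m x≤y) n∣)
  ... | inj₂ y≤x = ≈-sym (≤∧∣∸⇒≈ y≤x (subst (n ∣_) (m≤n⇒∣n-m∣≡n∸m y≤x) n∣))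

  ≈⇒∣-∣ : ∀ {x y} → x ≈ y → n ∣ ∣ x - y ∣
  ≈⇒∣-∣ {x} {y} p with ≤-total x y
  ... | inj₁ x≤y = subst (n ∣_) (sym (m≤n⇒∣m-n∣≡n∸m x≤y)) (≤∧≈⇒∣∸ x≤y p)
  ... | inj₂ y≤x = subst (n ∣_) (sym (m≤n⇒∣n-m∣≡n∸m y≤x)) (≤∧≈⇒∣∸ y≤x (≈-sym p))

  -- Divisibility in ℤ is divisibility of absolute values, so the integer condition in `IsCSD`
  -- becomes a statement about the distance of two natural numbers.
  ℤ∣⇒≈ : ∀ x y → + n ℤ.∣ (+ x ℤ.- + y) → x ≈ y
  ℤ∣⇒≈ x y n∣ = ∣-∣⇒≈ (subst (n ∣_) (∣⊖∣ x y) (subst (λ z → n ∣ ℤ.∣ z ∣) (ℤ.m-n≡m⊖n x y) n∣))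
    where
    ∣⊖∣ : ∀ x y → ℤ.∣ x ⊖ y ∣ ≡ ∣ x - y ∣
    ∣⊖∣ x y with ≤-total x y
    ... | inj₁ x≤y = trans (ℤ.∣⊖∣-≤ x≤y) (sym (m≤n⇒∣m-n∣≡n∸m x≤y))
    ... | inj₂ y≤x = trans (ℤ.∣m⊖n∣≡∣n⊖m∣ x y) (trans (ℤ.∣⊖∣-≤ y≤x) (sym (m≤n⇒∣n-m∣≡n∸m y≤x)))

-- Orbits of the rotation of ℤ/n by `c`.

module Rotation (n c : ℕ) .{{_ : NonZero n}} (0<c : 0 < c) (c+c<n : c + c < n) where

  open Congruence n

  orbits : ℕ
  orbits = gcd n c

  private
    instance
      orbits-nonZero : NonZero orbits
      orbits-nonZero = ≢-nonZero (gcd[m,n]≢0 n c (inj₁ (≢-nonZero⁻¹ n)))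

    n/d : ℕ
    n/d = quotient (gcd[m,n]∣m n c)

    n≡n/d*d : n ≡ n/d * orbits
    n≡n/d*d = m∣n⇒n≡quotient*m (gcd[m,n]∣m n c)

    c/d : ℕ
    c/d = quotient (gcd[m,n]∣n n c)

    c≡c/d*d : c ≡ c/d * orbits
    c≡c/d*d = m∣n⇒n≡quotient*m (gcd[m,n]∣n n c)

    0<c/d : 0 < c/d
    0<c/d = n≢0⇒n>0 λ c/d≡0 → <⇒≢ 0<c (sym (trans c≡c/d*d (cong (_* orbits) c/d≡0)))

    -- Dividing `c + c < n` by the gcd gives `c/d + c/d < n/d`, and `c/d` is at least 1. This rules
    -- out orbits too short to be cycles of a simple graph.
    3≤n/d : 3 ≤ n/d
    3≤n/d = ≤-<-trans (+-mono-≤ 0<c/d 0<c/d) (*-cancelʳ-< orbits (c/d + c/d) n/d (begin-strict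
      (c/d + c/d) * orbits          ≡⟨ *-distribʳ-+ orbits c/d c/d ⟩
      c/d * orbits + c/d * orbits   ≡⟨ cong₂ _+_ c≡c/d*d c≡c/d*d ⟨
      c + c                         <⟨ c+c<n ⟩
      n                             ≡⟨ n≡n/d*d ⟩
      n/d * orbits                  ∎))
      where open ≤-Reasoning

  excess : ℕ
  excess = n/d ∸ 3

  -- The order of `c` in ℤ/n, equal to `n/d`. The form `3 + excess` makes `Fin period` the index
  -- type of a `Cycle` definitionally.
  period : ℕ
  period = 3 + excess

  private
    n≡period*d : n ≡ period * orbits
    n≡period*d = trans n≡n/d*d (cong (_* orbits) (sym (m+[n∸m]≡n 3≤n/d)))

    coprime : Coprime period c/d
    -- `GCD-*` cancels the common factor `orbits` from `n`, `c` and their gcd, which therefore has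
    -- to be written `1 * orbits`.
    coprime = GCD≡1⇒coprime (GCD-* (subst₂ (λ a b → GCD a b (1 * orbits)) n≡period*d c≡c/d*d
      (subst (GCD n c) (sym (*-identityˡ orbits)) (gcd-GCD n c))))

  period*c≈0 : ∀ k → k * period * c ≈ 0
  period*c≈0 k = ∣⇒≈0 (divides (k * c/d) (begin
    k * period * c               ≡⟨ cong (k * period *_) c≡c/d*d ⟩
    k * period * (c/d * orbits)  ≡⟨ lemma k period c/d orbits ⟩
    k * c/d * (period * orbits)  ≡⟨ cong (k * c/d *_) n≡period*d ⟨
    k * c/d * n                  ∎))
    where
    open ≡-Reasoning
    lemma : ∀ k p q d → k * p * (q * d) ≡ k * q * (p * d)
    lemma = solve-∀

  %-period : ∀ i → i % period * c ≈ i * c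
  %-period i = begin
    i % period * c                                  ≡⟨ +-identityʳ _ ⟨
    i % period * c + 0                              ≈⟨ +-cong-≈ ≈-refl (period*c≈0 (i / period)) ⟨
    i % period * c + i / period * period * c        ≡⟨ *-distribʳ-+ c (i % period) _ ⟨
    (i % period + i / period * period) * c          ≡⟨ cong (_* c) (m≡m%n+[m/n]*n i period) ⟨
    i * c                                           ∎
    where open import Relation.Binary.Reasoning.Setoid ≈-setoid

  -- Dividing `n ∣ ∣ i - j ∣ * c` by the gcd leaves `period ∣ c/d * ∣ i - j ∣`. Coprimality removes
  -- `c/d`, and two numbers below `period` that are congruent modulo `period` are equal.
  *c-injective : ∀ {i j} → i < period → j < period → i * c ≈ j * c → i ≡ j
  *c-injective {i} {j} i<p j<p p = Congruence.≈⇒≡ period i<p j<p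
    (Congruence.∣-∣⇒≈ period (coprime-divisor coprime
      (*-cancelʳ-∣ orbits (subst₂ _∣_ n≡period*d ∣i-j∣*c (≈⇒∣-∣ p)))))
    where
    open ≡-Reasoning
    ∣i-j∣*c : ∣ i * c - j * c ∣ ≡ c/d * ∣ i - j ∣ * orbits
    ∣i-j∣*c = begin
      ∣ i * c - j * c ∣            ≡⟨ *-distribʳ-∣-∣ c i j ⟨
      ∣ i - j ∣ * c                ≡⟨ cong (∣ i - j ∣ *_) c≡c/d*d ⟩
      ∣ i - j ∣ * (c/d * orbits)   ≡⟨ lemma ∣ i - j ∣ c/d orbits ⟩
      c/d * ∣ i - j ∣ * orbits     ∎
      where
      lemma : ∀ a q d → a * (q * d) ≡ q * a * d
      lemma = solve-∀

  -- The gcd divides both `n` and `c`, so reducing modulo the gcd erases the multiples of `c` and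
  -- leaves `a` and `b`.
  orbits-disjoint : ∀ {a b} i j → a < orbits → b < orbits → a + i * c ≈ b + j * c → a ≡ b
  orbits-disjoint {a} {b} i j a<d b<d p = D.≈⇒≡ a<d b<d (D.≈-trans (drop a i)
    (D.≈-trans (D.∣-∣⇒≈ (∣-trans (gcd[m,n]∣m n c) (≈⇒∣-∣ p))) (D.≈-sym (drop b j))))
    where
    module D = Congruence orbits
    drop : ∀ a i → a D.≈ a + i * c
    drop a i = D.≈-trans (D.≈-reflexive (sym (+-identityʳ a)))
      (D.+-cong-≈ D.≈-refl (D.≈-sym (D.∣⇒≈0 (∣n⇒∣m*n i (gcd[m,n]∣n n c)))))

  private
    gcd-multiple : ∃[ y ] y * c ≈ orbits
    gcd-multiple with Bézout.identity (gcd-GCD n c)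
    ... | Bézout.-+ x y eq = y , ≈-trans (≈-reflexive (sym eq)) (+k*n-≈ orbits x)
    -- Here Bézout gives `orbits + y * c ≡ x * n`, so the coefficient sought is the negative of `y`,
    -- represented modulo `n` by `y * pred n`.
    ... | Bézout.+- x y eq = y * pred n , +-cancelˡ-≈ (y * c) (begin
      y * c + y * pred n * c      ≡⟨ lemma y (pred n) c ⟩
      y * c * suc (pred n)        ≡⟨ cong (y * c *_) (suc-pred n) ⟩
      0 + y * c * n               ≈⟨ +k*n-≈ 0 (y * c) ⟩
      0                           ≈⟨ +k*n-≈ 0 x ⟨
      x * n                       ≡⟨ eq ⟨
      orbits + y * c              ≡⟨ +-comm orbits (y * c) ⟩
      y * c + orbits              ∎)
      where
      open import Relation.Binary.Reasoning.Setoid ≈-setoid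
      lemma : ∀ y m c → y * c + y * m * c ≡ y * c * suc m
      lemma = solve-∀

  abstract
    -- Divide `t` by the gcd: the remainder picks the orbit, and the quotient part is a multiple of
    -- the gcd, hence by Bézout a multiple of `c` modulo `n`. Its multiplier matters only modulo
    -- `period`.
    reach : ∀ t → Σ[ a ∈ Fin orbits ] Σ[ i ∈ Fin period ] toℕ a + toℕ i * c ≈ t
    reach t with y , y*c≈d ← gcd-multiple = t mod orbits , (q * y) mod period , (begin
      toℕ (t mod orbits) + toℕ ((q * y) mod period) * c
        ≡⟨ cong₂ (λ a i → a + i * c) (toℕ-fromℕ< (m%n<n t orbits)) (toℕ-fromℕ< (m%n<n (q * y) period)) ⟩
      t % orbits + (q * y) % period * c   ≈⟨ +-cong-≈ ≈-refl (%-period (q * y)) ⟩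
      t % orbits + q * y * c              ≡⟨ cong (_+_ (t % orbits)) (*-assoc q y c) ⟩
      t % orbits + q * (y * c)            ≈⟨ +-cong-≈ ≈-refl (*-congˡ-≈ q y*c≈d) ⟩
      t % orbits + q * orbits             ≡⟨ m≡m%n+[m/n]*n t orbits ⟨
      t                                   ∎)
      where
      open import Relation.Binary.Reasoning.Setoid ≈-setoid
      q : ℕ
      q = t / orbits

-- Chordal labels as differences of ranks.

∣∧<2n⇒≡ : ∀ {n s} → n ∣ s → 0 < s → s < n + n → s ≡ n
∣∧<2n⇒≡     (divides zero refl)          () _
∣∧<2n⇒≡ {n} (divides (suc zero) eq)      _  _    = trans eq (*-identityˡ n)
∣∧<2n⇒≡ {n} (divides (suc (suc q)) refl) _  s<2n = contradiction (+-monoʳ-≤ n (m≤m+n n (q * n))) (<⇒≱ s<2n)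

module ChordalLabeling {n : ℕ} .{{_ : NonZero n}} (G : Graph n) (lab : Labeling G) (csd : IsCSD G lab) where

  open Graph G
  open Congruence n

  private
    r : Fin n ⤖ Fin n
    r = proj₁ csd
    module r = Inverse (⤖⇒↔ r)

  rank : Fin n → ℕ
  rank v = toℕ (Bijection.to r v)

  -- Inverse of `rank`, extended periodically, so that `at (rank v + c)` is the image of `v` under
  -- the rotation by `c`.
  at : ℕ → Fin n
  at x = r.from (x mod n)

  rank<n : ∀ v → rank v < n
  rank<n v = toℕ<n _

  rank-injective : ∀ {u v} → rank u ≈ rank v → u ≡ v
  rank-injective p = Bijection.injective r (toℕ-injective (≈⇒≡ (rank<n _) (rank<n _) p))

  rank-at : ∀ x → rank (at x) ≈ x
  rank-at x = ≈-trans (≈-reflexive (trans (cong toℕ (r.strictlyInverseˡ (x mod n))) (toℕ-fromℕ< (m%n<n x n)))) (%-≈ x)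

  at≡ : ∀ {x v} → x ≈ rank v → at x ≡ v
  at≡ p = rank-injective (≈-trans (rank-at _) p)

  at≡⇒≈ : ∀ {x v} → at x ≡ v → x ≈ rank v
  at≡⇒≈ refl = ≈-sym (rank-at _)

  1≤lab : ∀ {u v} (e : Adj u v) → 1 ≤ lab u v e
  1≤lab e = proj₁ (proj₂ csd _ _ e)

  lab<n : ∀ {u v} (e : Adj u v) → lab u v e < n
  lab<n e = proj₁ (proj₂ (proj₂ csd _ _ e))

  rank+lab : ∀ {u v} (e : Adj u v) → rank u + lab u v e ≈ rank v
  rank+lab {u} {v} e = ℤ∣⇒≈ (rank u + lab u v e) (rank v)
    (subst (λ z → n ∣ ℤ.∣ z ∣) (lemma (+ rank u) (+ rank v) (+ lab u v e)) (proj₂ (proj₂ (proj₂ csd u v e))))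
    where
    lemma : ∀ x y l → l ℤ.- (y ℤ.- x) ≡ (x ℤ.+ l) ℤ.- y
    lemma = ℤ.solve-∀

  lab-unique : ∀ {u v c} (e : Adj u v) → c < n → rank u + c ≈ rank v → lab u v e ≡ c
  lab-unique {u} e c<n p = ≈⇒≡ (lab<n e) c<n (+-cancelˡ-≈ (rank u) (≈-trans (rank+lab e) (≈-sym p)))

  -- Going along the edge and back restores the rank, so the sum is a multiple of `n`; the bounds on
  -- labels place it strictly between 0 and `n + n`.
  lab-reverse : ∀ {u v} (e : Adj u v) (e′ : Adj v u) → lab u v e + lab v u e′ ≡ n
  lab-reverse {u} {v} e e′ = ∣∧<2n⇒≡ (≈0⇒∣ (+-cancelˡ-≈ (rank u) (begin
    rank u + (lab u v e + lab v u e′)   ≡⟨ +-assoc (rank u) _ _ ⟨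
    rank u + lab u v e + lab v u e′     ≈⟨ +-cong-≈ (rank+lab e) ≈-refl ⟩
    rank v + lab v u e′                 ≈⟨ rank+lab e′ ⟩
    rank u                              ≡⟨ +-identityʳ (rank u) ⟨
    rank u + 0                          ∎)))
    (≤-trans (1≤lab e) (m≤m+n _ _)) (+-mono-< (lab<n e) (lab<n e′))
    where open import Relation.Binary.Reasoning.Setoid ≈-setoid

  -- The 2-factor traced out by a rotation.

  module RotationFactor (c : ℕ) (0<c : 0 < c) (c+c<n : c + c < n)
                        (adj-at : ∀ v → Adj v (at (rank v + c))) where

    open Rotation n c 0<c c+c<n

    private
      c<n : c < n
      c<n = ≤-<-trans (m≤m+n c c) c+c<n

      point : Fin orbits → Fin period → Fin n
      point a i = at (toℕ a + toℕ i * c)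

      point-next : ∀ a i → rank (point a i) + c ≈ rank (point a (next G i))
      point-next a i = begin
        rank (point a i) + c              ≈⟨ +-cong-≈ (rank-at _) ≈-refl ⟩
        toℕ a + toℕ i * c + c             ≡⟨ +-assoc (toℕ a) _ c ⟩
        toℕ a + (toℕ i * c + c)           ≡⟨ cong (_+_ (toℕ a)) (+-comm _ c) ⟩
        -- This covers the wrap-around from the last index to 0, since a full period of steps adds 0
        -- modulo `n`.
        toℕ a + suc (toℕ i) * c           ≈⟨ +-cong-≈ ≈-refl (%-period (suc (toℕ i))) ⟨
        toℕ a + suc (toℕ i) % period * c  ≡⟨ cong (λ x → toℕ a + x * c) (toℕ-fromℕ< (m%n<n (suc (toℕ i)) period)) ⟨
        toℕ a + toℕ (next G i) * c        ≈⟨ rank-at _ ⟨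
        rank (point a (next G i))         ∎
        where open import Relation.Binary.Reasoning.Setoid ≈-setoid

      point≡⇒≈ : ∀ a i b j → point a i ≡ point b j → toℕ a + toℕ i * c ≈ toℕ b + toℕ j * c
      point≡⇒≈ a i b j eq = ≈-trans (at≡⇒≈ eq) (rank-at _)

      orbit : Fin orbits → Cycle G
      orbit a = record
        { excess   = excess
        ; vertex   = point a
        ; distinct = λ {i} {j} eq → toℕ-injective
            (*c-injective (toℕ<n i) (toℕ<n j) (+-cancelˡ-≈ (toℕ a) (point≡⇒≈ a i a j eq)))
        ; adjacent = λ i → subst (Adj (point a i)) (at≡ (point-next a i)) (adj-at (point a i))
        }

      abstract
        on-orbit : ∀ v → Σ[ a ∈ Fin orbits ] Σ[ i ∈ Fin period ] point a i ≡ v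
        on-orbit v with a , i , p ← reach (rank v) = a , i , at≡ p

    factor : TwoFactor G
    factor = record
      { size            = orbits
      ; cycle           = orbit
      ; vertex-disjoint = λ { a b a≢b v (i , p) (j , q) → a≢b (toℕ-injective
          (orbits-disjoint (toℕ i) (toℕ j) (toℕ<n a) (toℕ<n b) (point≡⇒≈ a i b j (trans p (sym q))))) }
      ; spanning        = on-orbit
      }

    open Subgraph

    factor-edge⇒lab : ∀ {u v} (e : Adj u v) (e′ : Adj v u) → E (TwoFactor.subgraph factor) u v →
      lab u v e ≡ c ⊎ lab v u e′ ≡ c
    factor-edge⇒lab e e′ (a , inj₁ (i , refl , refl)) = inj₁ (lab-unique e c<n (point-next a i))
    factor-edge⇒lab e e′ (a , inj₂ (i , refl , refl)) = inj₂ (lab-unique e′ c<n (point-next a i))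

    -- Some orbit passes through `u`, and its next point has rank `rank u + c` modulo `n`, which is
    -- the rank of `v`.
    lab⇒factor-edge : ∀ {u v} (e : Adj u v) → lab u v e ≡ c → E (TwoFactor.subgraph factor) u v
    lab⇒factor-edge {u} {v} e refl with a , i , p ← on-orbit u =
      a , inj₁ (i , p , rank-injective (≈-trans (≈-sym (point-next a i))
        (subst (λ w → rank w + lab u v e ≈ rank v) (sym p) (rank+lab e))))

-- Regular graphs: mirror symmetry of the labels and the 2-factors.

module RegularChordalLabeling
    {n k : ℕ} .{{_ : NonZero n}} (G : Graph n) (regular : Graph.Regular G k)
    (lab : Labeling G) (csd : IsCSD G lab)
    (γ : Fin k → ℕ) (γ-mono : ∀ {i j} → i Fin.< j → γ i < γ j) (uses : UsesExactly G lab γ) where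

  open Graph G
  open Congruence n
  open ChordalLabeling G lab csd
  open Subgraph

  label-index : ∀ {u v} (e : Adj u v) → ∃[ i ] γ i ≡ lab u v e
  label-index e = Equivalence.to (uses _) (_ , _ , e , refl)

  labelled-edge : ∀ i → Used G lab (γ i)
  labelled-edge i = Equivalence.from (uses _) (i , refl)

  abstract
    -- `index` sends each neighbour of `v` to the position of its label. Equal labels at `v` force
    -- equal ranks, so `index` is injective; there are as many neighbours as labels, so it takes the
    -- value `i`.
    neighbour : ∀ v i → ∃[ w ] Σ[ e ∈ Adj v w ] lab v w e ≡ γ i
    neighbour v i
      with f , f-inj , f∈ ← enumerate-size (neighbours v) (regular v)
      = f j , adj-f j , trans (sym (proj₂ (label-index (adj-f j)))) (cong γ index≡i)
      where
      adj-f : ∀ j → Adj v (f j)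
      adj-f j = subst T (trans (sym ([]=⇒lookup (f∈ j))) (lookup∘tabulate (adj v) (f j))) tt

      index : Fin k → Fin k
      index j = proj₁ (label-index (adj-f j))

      index-injective : Injective _≡_ _≡_ index
      index-injective {j} {j′} eq = f-inj (rank-injective (begin
        rank (f j)                        ≈⟨ rank+lab (adj-f j) ⟨
        rank v + lab v (f j) (adj-f j)    ≡⟨ cong (_+_ (rank v)) (proj₂ (label-index (adj-f j))) ⟨
        rank v + γ (index j)              ≡⟨ cong (λ i → rank v + γ i) eq ⟩
        rank v + γ (index j′)             ≡⟨ cong (_+_ (rank v)) (proj₂ (label-index (adj-f j′))) ⟩
        rank v + lab v (f j′) (adj-f j′)  ≈⟨ rank+lab (adj-f j′) ⟩
        rank (f j′)                       ∎))
        where open import Relation.Binary.Reasoning.Setoid ≈-setoid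

      j : Fin k
      j = proj₁ (injective⇒covering index-injective i)
      index≡i : index j ≡ i
      index≡i = proj₂ (injective⇒covering index-injective i)

  adj-at : ∀ i v → Adj v (at (rank v + γ i))
  adj-at i v with w , e , eq ← neighbour v i =
    subst (Adj v) (sym (at≡ (subst (λ c → rank v + c ≈ rank w) eq (rank+lab e)))) e

  0<γ : ∀ i → 0 < γ i
  0<γ i with _ , _ , e , eq ← labelled-edge i = subst (0 <_) eq (1≤lab e)

  γ-cancel-< : ∀ {i j} → γ i < γ j → i Fin.< j
  γ-cancel-< {i} {j} γi<γj with Fin.<-cmp i j
  ... | tri< i<j _ _    = i<j
  ... | tri≈ _ refl _   = contradiction γi<γj (<-irrefl refl)
  ... | tri> _ _ j<i    = contradiction γi<γj (<-asym (γ-mono j<i))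

  private
    abstract
      -- An edge labelled `γ i` carries `n ∸ γ i` at its other end, so that number is a used label
      -- too.
      partner : ∀ i → ∃[ j ] γ i + γ j ≡ n
      partner i with u , v , e , eq ← labelled-edge i =
        let j , γj≡ = label-index (adj-sym u v e)
        in  j , trans (cong₂ _+_ (sym eq) γj≡) (lab-reverse e (adj-sym u v e))

  γ+γ-opposite : ∀ i → γ i + γ (opposite i) ≡ n
  γ+γ-opposite i = subst (λ j → γ i + γ j ≡ n)
    (strictlyAntitone⇒opposite (proj₁ ∘ partner) partner-antitone i) (proj₂ (partner i))
    where
    -- The sum with the partner is always `n`, so a larger label needs a smaller partner.
    partner-antitone : ∀ {i j} → i Fin.< j → proj₁ (partner j) Fin.< proj₁ (partner i)
    partner-antitone {i} {j} i<j = γ-cancel-< (≰⇒> λ le → <⇒≢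
      (+-mono-<-≤ (γ-mono i<j) le) (trans (proj₂ (partner i)) (sym (proj₂ (partner j)))))

  half : ℕ
  half = ⌊ k /2⌋

  half+half≤k : half + half ≤ k
  half+half≤k with ⌊n/2⌋+⌊n/2⌋-parity k
  ... | inj₁ eq = ≤-reflexive eq
  ... | inj₂ eq = ≤-trans (n≤1+n _) (≤-reflexive eq)

  k≤1+half+half : k ≤ suc (half + half)
  k≤1+half+half with ⌊n/2⌋+⌊n/2⌋-parity k
  ... | inj₁ eq = ≤-trans (≤-reflexive (sym eq)) (n≤1+n _)
  ... | inj₂ eq = ≤-reflexive (sym eq)

  γ+γ<n : ∀ j → toℕ j < half → γ j + γ j < n
  γ+γ<n j j<half = subst (γ j + γ j <_) (γ+γ-opposite j) (+-monoʳ-< (γ j) (γ-mono (≰⇒> λ opp≤j →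
    -- If `opposite j ≤ j`, then `k`, being `1 + j + opposite j`, is at most `1 + j + j`, which is
    -- below `half + half` and so below `k`.
    <⇒≱ (begin-strict
      suc (toℕ j + toℕ (opposite j))   ≤⟨ +-monoʳ-≤ (suc (toℕ j)) opp≤j ⟩
      suc (toℕ j + toℕ j)              <⟨ +-mono-≤-< j<half j<half ⟩
      half + half                      ∎)
      (≤-trans half+half≤k (≤-reflexive (sym (toℕ-opposite j)))))))
    where open ≤-Reasoning

  lower : Fin half → Fin k
  lower i = inject≤ i (⌊n/2⌋≤n k)

  γ-lower+γ-lower<n : ∀ i → γ (lower i) + γ (lower i) < n
  γ-lower+γ-lower<n i = γ+γ<n (lower i) (subst (_< half) (sym (toℕ-inject≤ i (⌊n/2⌋≤n k))) (toℕ<n i))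

  γ-lower-injective : ∀ {i j} → γ (lower i) ≡ γ (lower j) → i ≡ j
  γ-lower-injective {i} {j} eq with Fin.<-cmp (lower i) (lower j)
  ... | tri< lt _ _ = contradiction eq (<⇒≢ (γ-mono lt))
  ... | tri≈ _ p _  = Fin.inject≤-injective _ _ i j p
  ... | tri> _ _ gt = contradiction (sym eq) (<⇒≢ (γ-mono gt))

  module Factor (i : Fin half) =
    RotationFactor (γ (lower i)) (0<γ (lower i)) (γ-lower+γ-lower<n i) (adj-at (lower i))

  factors : Fin half → TwoFactor G
  factors = Factor.factor

  factorEdges : Fin half → Fin n → Fin n → Set
  factorEdges i = E (TwoFactor.subgraph (factors i))

  factors-labeled : ∀ i → EdgesLabeledWith G lab (γ (lower i)) (TwoFactor.subgraph (factors i))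
  factors-labeled i u v e = Factor.factor-edge⇒lab i _ _ e

  -- A common edge has a label from each factor. At the same end these coincide, so `i ≡ j`; at
  -- different ends they add up to `n`, although the double of each is below `n`.
  factors-disjoint : ∀ i j → i ≢ j → ∀ u v → factorEdges i u v → ¬ factorEdges j u v
  factors-disjoint i j i≢j u v eᵢ eⱼ = disjoint (Factor.factor-edge⇒lab i e e′ eᵢ) (Factor.factor-edge⇒lab j e e′ eⱼ)
    where
    e : Adj u v
    e = E⇒Adj (TwoFactor.subgraph (factors i)) eᵢ
    e′ : Adj v u
    e′ = adj-sym u v e

    γ+γ≢n : γ (lower i) + γ (lower j) ≢ n
    γ+γ≢n = [ (λ le → <⇒≢ (≤-<-trans (+-monoˡ-≤ _ le) (γ-lower+γ-lower<n j)))
            , (λ ge → <⇒≢ (≤-<-trans (+-monoʳ-≤ _ ge) (γ-lower+γ-lower<n i))) ]′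
            (≤-total (γ (lower i)) (γ (lower j)))

    disjoint : lab u v e ≡ γ (lower i) ⊎ lab v u e′ ≡ γ (lower i) →
               ¬ (lab u v e ≡ γ (lower j) ⊎ lab v u e′ ≡ γ (lower j))
    disjoint (inj₁ p) (inj₁ q) = i≢j (γ-lower-injective (trans (sym p) q))
    disjoint (inj₁ p) (inj₂ q) = γ+γ≢n (trans (cong₂ _+_ (sym p) (sym q)) (lab-reverse e e′))
    disjoint (inj₂ p) (inj₁ q) = γ+γ≢n (trans (cong₂ _+_ (sym p) (sym q)) (lab-reverse e′ e))
    disjoint (inj₂ p) (inj₂ q) = i≢j (γ-lower-injective (trans (sym p) q))

  lower-label⇒factor-edge : ∀ {u v} (e : Adj u v) j → toℕ j < half → lab u v e ≡ γ j → ∃[ i ] factorEdges i u v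
  lower-label⇒factor-edge e j j<half eq = i , Factor.lab⇒factor-edge i e (trans eq (cong γ (sym lower-i≡j)))
    where
    i : Fin half
    i = fromℕ< j<half
    lower-i≡j : lower i ≡ j
    lower-i≡j = toℕ-injective (trans (toℕ-inject≤ i (⌊n/2⌋≤n k)) (toℕ-fromℕ< j<half))

  -- Antipodal edges and the decomposition.

  -- The edges labelled `n/2`, expressed without division, so that the definition does not
  -- presuppose `n` even.
  antipodal : Subgraph G
  antipodal = record
    { V     = λ _ → ⊤
    ; E     = λ u v → Σ[ e ∈ Adj u v ] lab u v e + lab u v e ≡ n
    ; E-sym = λ { {u} {v} (e , eq) → let e′ = adj-sym u v e in
        e′ , trans (cong (_+ lab v u e′) (sym (+-cancelˡ-≡ _ _ _ (trans eq (sym (lab-reverse e e′))))))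
               (lab-reverse e e′) }
    ; E⇒V   = λ _ → tt
    ; E⇒Adj = proj₁
    }

  -- If neither label of an edge is among the lower half of γ, then its index j
  -- satisfies j = opposite j.
  factor-or-antipodal : ∀ {u v} → Adj u v →
    (∃[ i ] factorEdges i u v) ⊎ (E antipodal u v × suc (half + half) ≡ k)
  factor-or-antipodal {u} {v} e with label-index e
  ... | j , γj≡lab with toℕ j <? half | toℕ (opposite j) <? half
  ... | yes j<h | _ = inj₁ (lower-label⇒factor-edge e j j<h (sym γj≡lab))
  ... | no _ | yes j′<h = inj₁ (i , E-sym (TwoFactor.subgraph (factors i)) eᵢ)
    where
    e′ : Adj v u
    e′ = adj-sym u v e
    lab-e′ : lab v u e′ ≡ γ (opposite j)
    lab-e′ = +-cancelˡ-≡ (γ j) _ _ (trans (cong (_+ lab v u e′) γj≡lab)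
      (trans (lab-reverse e e′) (sym (γ+γ-opposite j))))
    found : ∃[ i ] factorEdges i v u
    found = lower-label⇒factor-edge e′ (opposite j) j′<h lab-e′
    i : Fin half
    i = proj₁ found
    eᵢ : factorEdges i v u
    eᵢ = proj₂ found
  ... | no j≮h | no j′≮h = inj₂ ((e , trans (cong₂ _+_ (sym γj≡lab) (sym γj≡lab)) γj+γj≡n)
                                , trans (cong suc (cong₂ _+_ (sym j≡h) (sym j′≡h))) (toℕ-opposite j))
    where
    h≤j : half ≤ toℕ j
    h≤j = ≮⇒≥ j≮h
    h≤j′ : half ≤ toℕ (opposite j)
    h≤j′ = ≮⇒≥ j′≮h
    -- The two indices add up to `k - 1`, which is at most `half + half`; each being at least
    -- `half`, both equal it.
    j+j′≤h+h : toℕ j + toℕ (opposite j) ≤ half + half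
    j+j′≤h+h = s≤s⁻¹ (≤-trans (≤-reflexive (toℕ-opposite j)) k≤1+half+half)
    j≡h : toℕ j ≡ half
    j≡h = ≤-antisym (+-cancelʳ-≤ half _ _ (≤-trans (+-monoʳ-≤ (toℕ j) h≤j′) j+j′≤h+h)) h≤j
    j′≡h : toℕ (opposite j) ≡ half
    j′≡h = ≤-antisym (+-cancelˡ-≤ half _ _ (≤-trans (+-monoˡ-≤ (toℕ (opposite j)) h≤j) j+j′≤h+h)) h≤j′
    γj+γj≡n : γ j + γ j ≡ n
    γj+γj≡n = trans (cong (λ i → γ j + γ i) (toℕ-injective (trans j≡h (sym j′≡h)))) (γ+γ-opposite j)

  factors-decompose : 1 ≤ k → 2 ∣ k → DecomposesInto G (TwoFactor.subgraph ∘ factors)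
  factors-decompose 1≤k 2∣k = record
    { vertices-covered = λ v → fromℕ< 0<half , TwoFactor.spanning (factors (fromℕ< 0<half)) v
    ; edges-covered    = λ u v e → [ id , (λ { (_ , odd) → contradiction odd even }) ]′ (factor-or-antipodal e)
    ; edge-disjoint    = factors-disjoint
    }
    where
    even : suc (half + half) ≢ k
    even odd = 2∤1+m+m half (subst (2 ∣_) (sym odd) 2∣k)

    -- A factor must exist to cover the vertices. With `half` zero, `k` would be 1, which is odd.
    0<half : 0 < half
    0<half with half in eq
    ... | zero  = contradiction (≤-antisym 1≤k (subst (λ h → k ≤ suc (h + h)) eq k≤1+half+half))
                    (subst (λ h → suc (h + h) ≢ k) eq even)
    ... | suc _ = s≤s z≤n

  module Odd (odd : suc (half + half) ≡ k) where

    private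
      mid : Fin k
      mid = fromℕ< (subst (half <_) odd (s≤s (m≤m+n half half)))

      mid≡half : toℕ mid ≡ half
      mid≡half = toℕ-fromℕ< _

      opposite-mid : opposite mid ≡ mid
      opposite-mid = toℕ-injective (+-cancelˡ-≡ (suc (toℕ mid)) _ _
        (trans (toℕ-opposite mid) (trans (sym odd) (cong suc (cong₂ _+_ (sym mid≡half) (sym mid≡half))))))

      γ-mid+γ-mid : γ mid + γ mid ≡ n
      γ-mid+γ-mid = subst (λ j → γ mid + γ j ≡ n) opposite-mid (γ+γ-opposite mid)

      γ-mid<n : γ mid < n
      γ-mid<n = subst (γ mid <_) γ-mid+γ-mid (m<m+n (γ mid) (0<γ mid))

      halve : ∀ {x} → x + x ≡ n → x ≡ ⌊ n /2⌋
      halve {x} eq = trans (n≡⌊n+n/2⌋ x) (cong ⌊_/2⌋ eq)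

    2∣n : 2 ∣ n
    2∣n = subst (2 ∣_) γ-mid+γ-mid (2∣m+m (γ mid))

    antipodal-labeled : EdgesLabeledWith G lab ⌊ n /2⌋ antipodal
    antipodal-labeled u v (e , eq) = inj₁ (halve eq)

    -- The partner of `v` is its neighbour along the middle label. It is unique because halving `n`
    -- shows that every antipodal edge carries that same label.
    antipodal-perfectMatching : IsPerfectMatching G antipodal
    antipodal-perfectMatching v = tt , at (rank v + γ mid) , (e , trans (cong₂ _+_ lab≡ lab≡) γ-mid+γ-mid)
      , λ { {w} (e′ , eq) → at≡ (subst (λ c → rank v + c ≈ rank w)
              (trans (halve eq) (sym (halve γ-mid+γ-mid))) (rank+lab e′)) }
      where
      e : Adj v (at (rank v + γ mid))
      e = adj-at mid v
      lab≡ : lab v (at (rank v + γ mid)) e ≡ γ mid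
      lab≡ = lab-unique e γ-mid<n (≈-sym (rank-at _))

    -- Each label of an antipodal edge doubles to exactly `n`, whereas the label of a factor doubles
    -- to less.
    antipodal-disjoint : ∀ i u v → E antipodal u v → ¬ factorEdges i u v
    antipodal-disjoint i u v (e , eq) eᵢ
      with Factor.factor-edge⇒lab i e (proj₁ (E-sym antipodal (e , eq))) eᵢ
    ... | inj₁ p = <⇒≢ (γ-lower+γ-lower<n i) (trans (cong₂ _+_ (sym p) (sym p)) eq)
    ... | inj₂ p = <⇒≢ (γ-lower+γ-lower<n i)
                     (trans (cong₂ _+_ (sym p) (sym p)) (proj₂ (E-sym antipodal (e , eq))))

    decompose : DecomposesInto G (antipodal ∷ (TwoFactor.subgraph ∘ factors))
    decompose = record
      { vertices-covered = λ v → zero , tt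
      ; edges-covered    = λ u v e → [ (λ { (i , eᵢ) → suc i , eᵢ }) , (λ { (eₐ , _) → zero , eₐ }) ]′ (factor-or-antipodal e)
      ; edge-disjoint    = disjoint
      }
      where
      disjoint : ∀ i j → i ≢ j → ∀ u v →
        E ((antipodal ∷ (TwoFactor.subgraph ∘ factors)) i) u v →
        ¬ E ((antipodal ∷ (TwoFactor.subgraph ∘ factors)) j) u v
      disjoint zero    zero    i≢j u v p q = i≢j refl
      disjoint zero    (suc j) i≢j u v p q = antipodal-disjoint j u v p q
      disjoint (suc i) zero    i≢j u v p q = antipodal-disjoint i u v q p
      disjoint (suc i) (suc j) i≢j u v p q = factors-disjoint i j (i≢j ∘ cong suc) u v p q

theorem2 : ∀ {n k : ℕ} (G : Graph n) → 1 ≤ k → Graph.Regular G k →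
    (lab : Labeling G) → IsMCSD G lab →
    (γ : Fin k → ℕ) → (∀ {i j} → i Fin.< j → γ i < γ j) → UsesExactly G lab γ →
    Σ[ F ∈ (Fin ⌊ k /2⌋ → TwoFactor G) ]
    ((∀ i → EdgesLabeledWith G lab (γ (inject≤ i (⌊n/2⌋≤n k))) (TwoFactor.subgraph (F i)))
    × (2 ∣ k → DecomposesInto G (λ i → TwoFactor.subgraph (F i)))
    × (¬ 2 ∣ k → Σ[ M ∈ Subgraph G ]
    (IsPerfectMatching G M
    × DecomposesInto G (M ∷ (λ i → TwoFactor.subgraph (F i)))
    × 2 ∣ n
    × EdgesLabeledWith G lab ⌊ n /2⌋ M)))
theorem2 {zero} G 1≤k regular lab mcsd γ γ-mono uses
  -- Since `1 ≤ k`, some label is used, and the edge that carries it would have an endpoint in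
  -- `Fin 0`.
  with () , _ ← Equivalence.from (uses (γ (fromℕ< 1≤k))) (fromℕ< 1≤k , refl)
theorem2 {suc n} {k} G 1≤k regular lab mcsd γ γ-mono uses =
  factors , factors-labeled , factors-decompose 1≤k , λ 2∤k →
    let open Odd (odd 2∤k) in
    antipodal , antipodal-perfectMatching , decompose , 2∣n , antipodal-labeled
  where
  open RegularChordalLabeling G regular lab (proj₁ mcsd) γ γ-mono uses

  odd : ¬ 2 ∣ k → suc (half + half) ≡ k
  odd 2∤k with ⌊n/2⌋+⌊n/2⌋-parity k
  ... | inj₁ eq = contradiction (subst (2 ∣_) eq (2∣m+m half)) 2∤k
  ... | inj₂ eq = eq
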